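{- Let $A_i, A_j, A_k, A_l$ be four distinct points lying on a circle in the Euclidean plane, in anticlockwise order (i.e. going around the circle anticlockwise one meets $A_i, A_j, A_k, A_l$ in this cyclic order). Then \[ \begin{vmatrix} x_{kl} & S_{ikl} & S_{jkl}\\ -x_{ij} & S_{ijk} & S_{ijl}\\ 0 & x_{ik} & x_{jl} \end{vmatrix} = \begin{vmatrix} x_{kl} & S_{ikl} & S_{jkl}\\ x_{ij} & S_{ijl} & S_{ijk}\\ 0 & x_{il} & x_{jk} \end{vmatrix} = \begin{vmatrix} x_{jk} & S_{ijk} & S_{jkl}\\ -x_{il} & S_{ikl} & S_{ijl}\\ 0 & x_{ik} & x_{jl} \end{vmatrix} = 0.\]
   Context: For points $A_p=(x_p,y_p)$ in the plane, $x_{pq}:=(x_q-x_p)^2+(y_q-y_p)^2$ denotes the squared distance between $A_p$ and $A_q$, and $S_{pqr}:=2[(x_q-x_p)(y_r-y_p)-(y_q-y_p)(x_r-x_p)]$ denotes four times the signed area of the triangle $A_pA_qA_r$ (positive when $A_p,A_q,A_r$ are ordered anticlockwise). -}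

module Defs where

open import Algebra.Bundles using (CommutativeRing; AbelianGroup)
import Algebra.Properties.AbelianGroup as AbelianGroupProperties
import Algebra.Properties.CommutativeSemigroup as CommutativeSemigroupProperties
open import Algebra.Structures using (IsCommutativeRing)
open import Data.Fin.Base using (Fin; zero; suc; punchIn)
import Data.List.Relation.Unary.Unique.Setoid as UniqueSetoid
open import Data.Nat.Base as ℕ using (ℕ; zero; suc)
import Data.Nat.Properties as ℕ
open import Data.Product.Base using (∃; _×_; _,_; proj₁; proj₂)
open import Data.Product.Relation.Binary.Pointwise.NonDependent using (×-setoid)
open import Data.Rational.Base as ℚ using (ℚ; 0ℚ; 1ℚ; ½; ∣_∣)
import Data.Rational.Properties as ℚ
open import Data.Vec.Functional as Vector using (Vector)
open import Level using (0ℓ)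
open import Relation.Binary.Bundles using (Setoid)
open import Relation.Binary.PropositionalEquality
  using (_≡_; refl; sym; trans; cong; cong₂; subst; module ≡-Reasoning)
open import Relation.Binary.Structures using (IsEquivalence)

-- A real number is a Cauchy sequence of rationals; two of them are equal
-- (_≈_) when their difference tends to 0, and x < y when, from some index
-- on, y exceeds x by a fixed positive rational.

Cauchy : (ℕ → ℚ) → Set
Cauchy f = ∀ ε → 0ℚ ℚ.< ε →
  ∃ λ N → ∀ m n → N ℕ.≤ m → N ℕ.≤ n → ∣ f m ℚ.- f n ∣ ℚ.< ε

Null : (ℕ → ℚ) → Set
Null f = ∀ ε → 0ℚ ℚ.< ε → ∃ λ N → ∀ n → N ℕ.≤ n → ∣ f n ∣ ℚ.< ε

record ℝ : Set where
  constructor mkℝ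
  field
    seq    : ℕ → ℚ
    cauchy : Cauchy seq

open ℝ public

infix 4 _≈_ _<_

_≈_ : ℝ → ℝ → Set
x ≈ y = Null (λ n → seq x n ℚ.- seq y n)

_<_ : ℝ → ℝ → Set
x < y = ∃ λ ε → (0ℚ ℚ.< ε) ×
  (∃ λ N → ∀ n → N ℕ.≤ n → seq x n ℚ.+ ε ℚ.≤ seq y n)

private

  module ℚ-AbelianGroup = AbelianGroupProperties ℚ.+-0-abelianGroup
  module ℚ-Semigroup = CommutativeSemigroupProperties
    (AbelianGroup.commutativeSemigroup ℚ.+-0-abelianGroup)

  -+-cancel : ∀ a b → (a ℚ.- b) ℚ.+ b ≡ a
  -+-cancel a b = trans (ℚ.+-assoc a (ℚ.- b) b)
    (trans (cong (a ℚ.+_) (ℚ.+-inverseˡ b)) (ℚ.+-identityʳ a))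

  minus-flip : ∀ a b → ℚ.- (a ℚ.- b) ≡ b ℚ.- a
  minus-flip = ℚ-AbelianGroup.⁻¹-anti-homo‿-

  neg-minus : ∀ a b → ℚ.- (a ℚ.- b) ≡ (ℚ.- a) ℚ.- (ℚ.- b)
  neg-minus a b = ℚ.neg-distrib-+ a (ℚ.- b)

  minus-chain : ∀ a b c → (a ℚ.- b) ℚ.+ (b ℚ.- c) ≡ a ℚ.- c
  minus-chain a b c = trans (sym (ℚ.+-assoc (a ℚ.- b) b (ℚ.- c)))
    (cong (ℚ._- c) (-+-cancel a b))

  plus-minus : ∀ a b c d → (a ℚ.- b) ℚ.+ (c ℚ.- d) ≡ (a ℚ.+ c) ℚ.- (b ℚ.+ d)
  plus-minus a b c d = trans (ℚ-Semigroup.interchange a (ℚ.- b) c (ℚ.- d))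
    (cong ((a ℚ.+ c) ℚ.+_) (sym (ℚ.neg-distrib-+ b d)))

  times-minus : ∀ a b c d →
    a ℚ.* (c ℚ.- d) ℚ.+ d ℚ.* (a ℚ.- b) ≡ a ℚ.* c ℚ.- b ℚ.* d
  times-minus a b c d = begin
    a ℚ.* (c ℚ.- d) ℚ.+ d ℚ.* (a ℚ.- b)
      ≡⟨ cong₂ ℚ._+_ (distrib a c d) (distrib d a b) ⟩
    (a ℚ.* c ℚ.- a ℚ.* d) ℚ.+ (d ℚ.* a ℚ.- d ℚ.* b)
      ≡⟨ cong₂ (λ t u → (a ℚ.* c ℚ.- a ℚ.* d) ℚ.+ (t ℚ.- u)) (ℚ.*-comm d a) (ℚ.*-comm d b) ⟩
    (a ℚ.* c ℚ.- a ℚ.* d) ℚ.+ (a ℚ.* d ℚ.- b ℚ.* d)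
      ≡⟨ minus-chain (a ℚ.* c) (a ℚ.* d) (b ℚ.* d) ⟩
    a ℚ.* c ℚ.- b ℚ.* d ∎
    where
      open ≡-Reasoning
      distrib : ∀ p q r → p ℚ.* (q ℚ.- r) ≡ p ℚ.* q ℚ.- p ℚ.* r
      distrib p q r = trans (ℚ.*-distribˡ-+ p q (ℚ.- r))
        (cong (p ℚ.* q ℚ.+_) (sym (ℚ.neg-distribʳ-* p r)))

  half>0 : ∀ {ε} → 0ℚ ℚ.< ε → 0ℚ ℚ.< ½ ℚ.* ε
  half>0 {ε} h = ℚ.*-monoʳ-<-pos ½ h

  half+half : ∀ ε → ½ ℚ.* ε ℚ.+ ½ ℚ.* ε ≡ ε
  half+half ε = trans (sym (ℚ.*-distribʳ-+ ε ½ ½)) (ℚ.*-identityˡ ε)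

  small-+ : ∀ a b {ε} → ∣ a ∣ ℚ.< ½ ℚ.* ε → ∣ b ∣ ℚ.< ½ ℚ.* ε → ∣ a ℚ.+ b ∣ ℚ.< ε
  small-+ a b {ε} p q = subst (∣ a ℚ.+ b ∣ ℚ.<_) (half+half ε)
    (ℚ.≤-<-trans (ℚ.∣p+q∣≤∣p∣+∣q∣ a b) (ℚ.+-mono-< p q))

  over : ∀ {A} → 0ℚ ℚ.< A → ℚ → ℚ
  over {A} A>0 ε = ε ℚ.* ℚ.1/_ A {{ℚ.pos⇒nonZero A {{ℚ.positive A>0}}}}

  over>0 : ∀ {A} (A>0 : 0ℚ ℚ.< A) {ε} → 0ℚ ℚ.< ε → 0ℚ ℚ.< over A>0 ε
  over>0 {A} A>0 {ε} ε>0 = ℚ.positive⁻¹ _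
    {{ℚ.pos*pos⇒pos ε {{ℚ.positive ε>0}} _ {{ℚ.1/pos⇒pos A {{ℚ.positive A>0}}}}}}

  over-* : ∀ {A} (A>0 : 0ℚ ℚ.< A) ε → A ℚ.* over A>0 ε ≡ ε
  over-* {A} A>0 ε = begin
    A ℚ.* (ε ℚ.* A⁻¹)   ≡⟨ ℚ.*-comm A _ ⟩
    (ε ℚ.* A⁻¹) ℚ.* A   ≡⟨ ℚ.*-assoc ε A⁻¹ A ⟩
    ε ℚ.* (A⁻¹ ℚ.* A)   ≡⟨ cong (ε ℚ.*_) (ℚ.*-inverseˡ A {{nz}}) ⟩
    ε ℚ.* 1ℚ            ≡⟨ ℚ.*-identityʳ ε ⟩
    ε                   ∎
    where
      open ≡-Reasoning
      nz  = ℚ.pos⇒nonZero A {{ℚ.positive A>0}}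
      A⁻¹ = ℚ.1/_ A {{nz}}

  small-* : ∀ {A} (A>0 : 0ℚ ℚ.< A) {ε} a d → ∣ a ∣ ℚ.≤ A →
            ∣ d ∣ ℚ.< over A>0 ε → ∣ a ℚ.* d ∣ ℚ.< ε
  small-* {A} A>0 {ε} a d a≤A d<δ =
    subst (ℚ._< ε) (sym (ℚ.∣p*q∣≡∣p∣*∣q∣ a d))
      (ℚ.≤-<-trans (ℚ.*-monoʳ-≤-nonNeg ∣ d ∣ {{ℚ.∣-∣-nonNeg d}} a≤A)
        (subst (A ℚ.* ∣ d ∣ ℚ.<_) (over-* A>0 ε)
          (ℚ.*-monoʳ-<-pos A {{ℚ.positive A>0}} d<δ)))

  EventuallyBounded : (ℕ → ℚ) → Set
  EventuallyBounded f =
    ∃ λ A → (0ℚ ℚ.< A) × (∃ λ N → ∀ n → N ℕ.≤ n → ∣ f n ∣ ℚ.≤ A)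

  cauchy⇒bounded : ∀ f → Cauchy f → EventuallyBounded f
  cauchy⇒bounded f c = A , A>0 , N , bound
    where
      0<1 : 0ℚ ℚ.< 1ℚ
      0<1 = ℚ.positive⁻¹ 1ℚ
      N = proj₁ (c 1ℚ 0<1)
      A = 1ℚ ℚ.+ ∣ f N ∣
      A>0 : 0ℚ ℚ.< A
      A>0 = ℚ.+-mono-<-≤ 0<1 (ℚ.0≤∣p∣ (f N))
      bound : ∀ n → N ℕ.≤ n → ∣ f n ∣ ℚ.≤ A
      bound n N≤n = subst (λ t → ∣ t ∣ ℚ.≤ A) (-+-cancel (f n) (f N))
        (ℚ.≤-trans (ℚ.∣p+q∣≤∣p∣+∣q∣ (f n ℚ.- f N) (f N))
          (ℚ.+-monoˡ-≤ ∣ f N ∣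
            (ℚ.<⇒≤ (proj₂ (c 1ℚ 0<1) n N N≤n ℕ.≤-refl))))

  null-ext : ∀ f g → (∀ n → f n ≡ g n) → Null f → Null g
  null-ext f g f≡g nf ε ε>0 with nf ε ε>0
  ... | N , p = N , λ n N≤n → subst (λ t → ∣ t ∣ ℚ.< ε) (f≡g n) (p n N≤n)

  null-0 : Null (λ _ → 0ℚ)
  null-0 ε ε>0 = 0 , λ _ _ → ε>0

  null-neg : ∀ f → Null f → Null (λ n → ℚ.- f n)
  null-neg f nf ε ε>0 with nf ε ε>0
  ... | N , p = N , λ n N≤n → subst (ℚ._< ε) (sym (ℚ.∣-p∣≡∣p∣ (f n))) (p n N≤n)

  null-+ : ∀ f g → Null f → Null g → Null (λ n → f n ℚ.+ g n)
  null-+ f g nf ng ε ε>0 with nf _ (half>0 ε>0) | ng _ (half>0 ε>0)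
  ... | M , p | N , q = M ℕ.⊔ N , λ n h →
    small-+ (f n) (g n) (p n (ℕ.m⊔n≤o⇒m≤o M N h)) (q n (ℕ.m⊔n≤o⇒n≤o M N h))

  null-* : ∀ f g → EventuallyBounded f → Null g → Null (λ n → f n ℚ.* g n)
  null-* f g (A , A>0 , M , p) ng ε ε>0 with ng _ (over>0 A>0 ε>0)
  ... | N , q = M ℕ.⊔ N , λ n h →
    small-* A>0 (f n) (g n) (p n (ℕ.m⊔n≤o⇒m≤o M N h)) (q n (ℕ.m⊔n≤o⇒n≤o M N h))

abstract

  cauchy-const : ∀ q → Cauchy (λ _ → q)
  cauchy-const q ε ε>0 = 0 , λ _ _ _ _ →
    subst (λ t → ∣ t ∣ ℚ.< ε) (sym (ℚ.+-inverseʳ q)) ε>0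

  cauchy-neg : ∀ f → Cauchy f → Cauchy (λ n → ℚ.- f n)
  cauchy-neg f c ε ε>0 with c ε ε>0
  ... | N , p = N , λ m n hm hn →
    subst (ℚ._< ε) (trans (sym (ℚ.∣-p∣≡∣p∣ (f m ℚ.- f n))) (cong ∣_∣ (neg-minus (f m) (f n))))
      (p m n hm hn)

  cauchy-+ : ∀ f g → Cauchy f → Cauchy g → Cauchy (λ n → f n ℚ.+ g n)
  cauchy-+ f g cf cg ε ε>0 with cf _ (half>0 ε>0) | cg _ (half>0 ε>0)
  ... | M , p | N , q = M ℕ.⊔ N , λ m n hm hn →
    subst (λ t → ∣ t ∣ ℚ.< ε) (plus-minus (f m) (f n) (g m) (g n))
      (small-+ (f m ℚ.- f n) (g m ℚ.- g n)
               (p m n (ℕ.m⊔n≤o⇒m≤o M N hm) (ℕ.m⊔n≤o⇒m≤o M N hn))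
               (q m n (ℕ.m⊔n≤o⇒n≤o M N hm) (ℕ.m⊔n≤o⇒n≤o M N hn)))

  cauchy-* : ∀ f g → Cauchy f → Cauchy g → Cauchy (λ n → f n ℚ.* g n)
  cauchy-* f g cf cg ε ε>0 with cauchy⇒bounded f cf | cauchy⇒bounded g cg
  ... | A , A>0 , K , a | B , B>0 , L , b
    with cg _ (over>0 A>0 (half>0 ε>0)) | cf _ (over>0 B>0 (half>0 ε>0))
  ... | M , p | N , q = (K ℕ.⊔ L) ℕ.⊔ (M ℕ.⊔ N) , λ m n hm hn →
    subst (λ t → ∣ t ∣ ℚ.< ε) (times-minus (f m) (f n) (g m) (g n))
      (small-+ (f m ℚ.* (g m ℚ.- g n)) (g n ℚ.* (f m ℚ.- f n))
        (small-* A>0 (f m) (g m ℚ.- g n) (a m (≤K hm)) (p m n (≤M hm) (≤M hn)))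
        (small-* B>0 (g n) (f m ℚ.- f n) (b n (≤L hn)) (q m n (≤N hm) (≤N hn))))
    where
      ≤KL : ∀ {m} → (K ℕ.⊔ L) ℕ.⊔ (M ℕ.⊔ N) ℕ.≤ m → K ℕ.⊔ L ℕ.≤ m
      ≤KL = ℕ.m⊔n≤o⇒m≤o (K ℕ.⊔ L) (M ℕ.⊔ N)
      ≤MN : ∀ {m} → (K ℕ.⊔ L) ℕ.⊔ (M ℕ.⊔ N) ℕ.≤ m → M ℕ.⊔ N ℕ.≤ m
      ≤MN = ℕ.m⊔n≤o⇒n≤o (K ℕ.⊔ L) (M ℕ.⊔ N)
      ≤K : ∀ {m} → (K ℕ.⊔ L) ℕ.⊔ (M ℕ.⊔ N) ℕ.≤ m → K ℕ.≤ m
      ≤K h = ℕ.m⊔n≤o⇒m≤o K L (≤KL h)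
      ≤L : ∀ {m} → (K ℕ.⊔ L) ℕ.⊔ (M ℕ.⊔ N) ℕ.≤ m → L ℕ.≤ m
      ≤L h = ℕ.m⊔n≤o⇒n≤o K L (≤KL h)
      ≤M : ∀ {m} → (K ℕ.⊔ L) ℕ.⊔ (M ℕ.⊔ N) ℕ.≤ m → M ℕ.≤ m
      ≤M h = ℕ.m⊔n≤o⇒m≤o M N (≤MN h)
      ≤N : ∀ {m} → (K ℕ.⊔ L) ℕ.⊔ (M ℕ.⊔ N) ℕ.≤ m → N ℕ.≤ m
      ≤N h = ℕ.m⊔n≤o⇒n≤o M N (≤MN h)

infix  8 -_
infixl 7 _*_
infixl 6 _+_ _-_

fromℚ : ℚ → ℝ
fromℚ q = mkℝ (λ _ → q) (cauchy-const q)

0ℝ 1ℝ : ℝ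
0ℝ = fromℚ 0ℚ
1ℝ = fromℚ 1ℚ

_+_ _*_ : ℝ → ℝ → ℝ
x + y = mkℝ (λ n → seq x n ℚ.+ seq y n) (cauchy-+ (seq x) (seq y) (cauchy x) (cauchy y))
x * y = mkℝ (λ n → seq x n ℚ.* seq y n) (cauchy-* (seq x) (seq y) (cauchy x) (cauchy y))

-_ : ℝ → ℝ
- x = mkℝ (λ n → ℚ.- seq x n) (cauchy-neg (seq x) (cauchy x))

_-_ : ℝ → ℝ → ℝ
x - y = x + (- y)

private

  pointwise : ∀ {x y} → (∀ n → seq x n ≡ seq y n) → x ≈ y
  pointwise {x} {y} h = null-ext (λ _ → 0ℚ) (λ n → seq x n ℚ.- seq y n)
    (λ n → sym (trans (cong (ℚ._- seq y n) (h n)) (ℚ.+-inverseʳ (seq y n)))) null-0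

  _−_ : ℝ → ℝ → ℕ → ℚ
  (x − y) n = seq x n ℚ.- seq y n

  ≈-isEquivalence : IsEquivalence _≈_
  ≈-isEquivalence = record
    { refl  = λ {x} → pointwise {x} {x} (λ _ → refl)
    ; sym   = λ {x} {y} p → null-ext (λ n → ℚ.- (x − y) n) (y − x)
        (λ n → minus-flip (seq x n) (seq y n)) (null-neg (x − y) p)
    ; trans = λ {x} {y} {z} p q →
        null-ext (λ n → (x − y) n ℚ.+ (y − z) n) (x − z)
          (λ n → minus-chain (seq x n) (seq y n) (seq z n))
          (null-+ (x − y) (y − z) p q)
    }

  +-cong : ∀ {x y u v} → x ≈ y → u ≈ v → x + u ≈ y + v
  +-cong {x} {y} {u} {v} p q =
    null-ext (λ n → (x − y) n ℚ.+ (u − v) n) ((x + u) − (y + v))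
      (λ n → plus-minus (seq x n) (seq y n) (seq u n) (seq v n))
      (null-+ (x − y) (u − v) p q)

  *-cong : ∀ {x y u v} → x ≈ y → u ≈ v → x * u ≈ y * v
  *-cong {x} {y} {u} {v} p q =
    null-ext (λ n → seq x n ℚ.* (u − v) n ℚ.+ seq v n ℚ.* (x − y) n)
      ((x * u) − (y * v))
      (λ n → times-minus (seq x n) (seq y n) (seq u n) (seq v n))
      (null-+ (λ n → seq x n ℚ.* (u − v) n) (λ n → seq v n ℚ.* (x − y) n)
        (null-* (seq x) (u − v) (cauchy⇒bounded (seq x) (cauchy x)) q)
        (null-* (seq v) (x − y) (cauchy⇒bounded (seq v) (cauchy v)) p))

  neg-cong : ∀ {x y} → x ≈ y → - x ≈ - y
  neg-cong {x} {y} p = null-ext (λ n → ℚ.- (x − y) n) ((- x) − (- y))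
    (λ n → neg-minus (seq x n) (seq y n)) (null-neg (x − y) p)

  ℝ-isCommutativeRing : IsCommutativeRing _≈_ _+_ _*_ -_ 0ℝ 1ℝ
  ℝ-isCommutativeRing = record
    { isRing = record
      { +-isAbelianGroup = record
        { isGroup = record
          { isMonoid = record
            { isSemigroup = record
              { isMagma = record
                { isEquivalence = ≈-isEquivalence
                ; ∙-cong = λ {x} {y} {u} {v} → +-cong {x} {y} {u} {v}
                }
              ; assoc = λ x y z → pointwise {(x + y) + z} {x + (y + z)}
                  (λ n → ℚ.+-assoc (seq x n) (seq y n) (seq z n))
              }
            ; identity =
                (λ x → pointwise {0ℝ + x} {x} (λ n → ℚ.+-identityˡ (seq x n)))
              , (λ x → pointwise {x + 0ℝ} {x} (λ n → ℚ.+-identityʳ (seq x n)))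
            }
          ; inverse =
              (λ x → pointwise { - x + x} {0ℝ} (λ n → ℚ.+-inverseˡ (seq x n)))
            , (λ x → pointwise {x + - x} {0ℝ} (λ n → ℚ.+-inverseʳ (seq x n)))
          ; ⁻¹-cong = λ {x} {y} → neg-cong {x} {y}
          }
        ; comm = λ x y → pointwise {x + y} {y + x}
            (λ n → ℚ.+-comm (seq x n) (seq y n))
        }
      ; *-cong = λ {x} {y} {u} {v} → *-cong {x} {y} {u} {v}
      ; *-assoc = λ x y z → pointwise {(x * y) * z} {x * (y * z)}
          (λ n → ℚ.*-assoc (seq x n) (seq y n) (seq z n))
      ; *-identity =
          (λ x → pointwise {1ℝ * x} {x} (λ n → ℚ.*-identityˡ (seq x n)))
        , (λ x → pointwise {x * 1ℝ} {x} (λ n → ℚ.*-identityʳ (seq x n)))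
      ; distrib =
          (λ x y z → pointwise {x * (y + z)} {x * y + x * z}
            (λ n → ℚ.*-distribˡ-+ (seq x n) (seq y n) (seq z n)))
        , (λ x y z → pointwise {(y + z) * x} {y * x + z * x}
            (λ n → ℚ.*-distribʳ-+ (seq x n) (seq y n) (seq z n)))
      }
    ; *-comm = λ x y → pointwise {x * y} {y * x}
        (λ n → ℚ.*-comm (seq x n) (seq y n))
    }

ℝ-commutativeRing : CommutativeRing 0ℓ 0ℓ
ℝ-commutativeRing = record { isCommutativeRing = ℝ-isCommutativeRing }

open CommutativeRing ℝ-commutativeRing public using () renaming (setoid to ℝ-setoid)

Point : Set
Point = ℝ × ℝ

Point-setoid : Setoid 0ℓ 0ℓ
Point-setoid = ×-setoid ℝ-setoid ℝ-setoid

open UniqueSetoid Point-setoid public using () renaming (Unique to Distinct)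

2ℝ : ℝ
2ℝ = 1ℝ + 1ℝ

-- x_pq, the squared distance.
dist² : Point → Point → ℝ
dist² (xp , yp) (xq , yq) = (xq - xp) * (xq - xp) + (yq - yp) * (yq - yp)

-- S_pqr, four times the signed area of the triangle pqr.
S : Point → Point → Point → ℝ
S (xp , yp) (xq , yq) (xr , yr) =
  2ℝ * ((xq - xp) * (yr - yp) - (yq - yp) * (xr - xp))

record Circle : Set where
  field
    centre   : Point
    radius   : ℝ
    radius>0 : 0ℝ < radius

_liesOn_ : Point → Circle → Set
p liesOn c = dist² (Circle.centre c) p ≈ Circle.radius c * Circle.radius c

Anticlockwise : Point → Point → Point → Set
Anticlockwise p q r = 0ℝ < S p q r

-- For points of a circle, S p q r > 0 says that p, q, r are met in this
-- order going round anticlockwise.  A cyclic order is a ternary relation: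
-- four points come in the cyclic order p, q, r, s when each three of them,
-- listed in this order, are anticlockwise.
AnticlockwiseOrder : Point → Point → Point → Point → Set
AnticlockwiseOrder p q r s =
  Anticlockwise p q r × Anticlockwise p q s × Anticlockwise p r s × Anticlockwise q r s

Matrix : ℕ → Set
Matrix n = Vector (Vector ℝ n) n

sum : ∀ {n} → Vector ℝ n → ℝ
sum = Vector.foldr _+_ 0ℝ

alternate : ∀ {n} → Fin n → ℝ → ℝ
alternate zero    x = x
alternate (suc j) x = - alternate j x

-- Laplace expansion along the first row.
det : ∀ {n} → Matrix n → ℝ
det {zero}  M = 1ℝ
det {suc n} M = sum λ j →
  alternate j (M zero j * det (λ a b → M (suc a) (punchIn j b)))

{-# OPTIONS --safe #-}

-- Put T = S_ikl x_ij - S_ijl x_ik + S_ijk x_il, the incircle determinant of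
-- the four points.  The coefficients -S_jkl, S_ikl, -S_ijl, S_ijk have sum 0 and
-- are those of an affine dependence among A_i, A_j, A_k, A_l, so T may be computed
-- from the squared distances to any point of the plane instead of A_i; from the
-- centre, these are all equal to the squared radius, hence T = 0.  As polynomials
-- in the coordinates, each of the three determinants is T times a signed sum of
-- the six squared distances; comparing values at a few quadruples gives the signs.
module Submission where

import Defs
open import Algebra.Bundles using (CommutativeRing)
open import Data.List.Base as List using ()
open import Data.List.Relation.Unary.All as All using (All)
open import Data.Nat.Base using (ℕ)
open import Data.Product.Base using (_×_; _,_)
open import Data.Rational.Base as ℚ using (ℚ; 0ℚ; 1ℚ; ∣_∣)
import Data.Rational.Properties as ℚ
open import Data.Rational.Solver using (module +-*-Solver)
open import Data.Vec.Functional using (_∷_; [])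
open import Level using (0ℓ)
import Relation.Binary.Reasoning.Setoid as SetoidReasoning
import Relation.Binary.PropositionalEquality as ≡

module VanishingCombinations (R : CommutativeRing 0ℓ 0ℓ) where
  open CommutativeRing R
  open SetoidReasoning setoid

  -- All four values equal `w`, so each difference is zero. With areas as weights and `w` the
  -- squared radius, this makes `T` vanish once it is written from the centre.
  weighted-differences≈0 : ∀ s t u {p x y z w} → p ≈ w → x ≈ w → y ≈ w → z ≈ w →
    s * (x - p) - t * (y - p) + u * (z - p) ≈ 0#
  weighted-differences≈0 s t u {p} {x} {y} {z} {w} p≈w x≈w y≈w z≈w = begin
    s * (x - p) - t * (y - p) + u * (z - p)
      ≈⟨ +-cong (+-cong (term s x≈w) (-‿cong (term t y≈w))) (term u z≈w) ⟩
    0# - 0# + 0#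
      ≈⟨ +-identityʳ _ ⟩
    0# - 0#
      ≈⟨ -‿inverseʳ 0# ⟩
    0# ∎
    where
      term : ∀ s {x} → x ≈ w → s * (x - p) ≈ 0#
      term s {x} x≈w = begin
        s * (x - p) ≈⟨ *-congˡ (+-cong x≈w (-‿cong p≈w)) ⟩
        s * (w - w) ≈⟨ *-congˡ (-‿inverseʳ w) ⟩
        s * 0#      ≈⟨ zeroʳ s ⟩
        0# ∎

  multiple≈0 : ∀ {t} q {d} → d ≈ t * q → t ≈ 0# → d ≈ 0#
  multiple≈0 q d≈tq t≈0 = trans d≈tq (trans (*-congʳ t≈0) (zeroˡ q))

  all-equal-0 : ∀ {d₁ d₂ d₃} → d₁ ≈ 0# → d₂ ≈ 0# → d₃ ≈ 0# →
    (d₁ ≈ d₂) × (d₂ ≈ d₃) × (d₃ ≈ 0#)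
  all-equal-0 d₁≈0 d₂≈0 d₃≈0 = trans d₁≈0 (sym d₂≈0) , trans d₂≈0 (sym d₃≈0) , d₃≈0

open Defs
open ≡ using (_≡_; refl; sym; trans; cong; cong₂; subst)
open +-*-Solver using (Polynomial; solve; con; _:+_; _:*_; _:-_; :-_; _:=_)

module ℝ-Ring = CommutativeRing ℝ-commutativeRing

-- The operations on reals act termwise on sequences, so a polynomial identity over the reals
-- reduces to one over the rationals, where the ring solver proves it as a propositional equality.
pointwise-≡⇒≈ : ∀ x y → (∀ n → seq x n ≡ seq y n) → x ≈ y
pointwise-≡⇒≈ x y x≡y ε ε>0 = 0 , λ n _ → subst (λ t → ∣ t ∣ ℚ.< ε)
  (sym (trans (cong (ℚ._- seq y n) (x≡y n)) (ℚ.+-inverseʳ (seq y n)))) ε>0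

-- Used both for the rationals and for the formal polynomials of the ring solver;
-- the primed operators only give fixities to the parameters.
module Forms {A : Set} (_+_ _*_ : A → A → A) (-_ : A → A) (1# : A) where

  infixl 7 _*′_
  infixl 6 _+′_ _-′_ _⊖_

  _*′_ _+′_ _-′_ : A → A → A
  _*′_ = _*_
  _+′_ = _+_
  x -′ y = x + (- y)

  _⊖_ : A × A → A × A → A × A
  (x , y) ⊖ (x′ , y′) = x -′ x′ , y -′ y′

  norm² : A × A → A
  norm² (x , y) = x *′ x +′ y *′ y

  area : A × A → A × A → A
  area (x , y) (x′ , y′) = (1# +′ 1#) *′ (x *′ y′ -′ y *′ x′)

  -- Twice the determinant with rows (x, y, x² + y²) for the three vectors, expanded along its last
  -- column. At the vectors from A_i it gives the terms of `T`.
  incircle : A × A → A × A → A × A → A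
  incircle a b c = area b c *′ norm² a -′ area a c *′ norm² b +′ area a b *′ norm² c

  -- The 3 by 3 determinant with rows (a, b, c), (d, e, f), (0, g, h), expanded along its first
  -- column.
  det₀ : A → A → A → A → A → A → A → A → A
  det₀ a b c d e f g h = a *′ (e *′ h -′ f *′ g) -′ d *′ (b *′ h -′ c *′ g)

  -- a, b, c, p, q, r stand for the vectors ij, ik, il, jk, jl, kl.  All six are
  -- arguments because A_k - A_j equals (A_k - A_i) - (A_j - A_i) only propositionally.
  module Dets (a b c p q r : A × A) where
    det₁ det₂ det₃ factor₁ factor₂ factor₃ : A
    det₁ = det₀ (norm² r) (area b c) (area p q) (- norm² a) (area a b) (area a c) (norm² b) (norm² q)
    det₂ = det₀ (norm² r) (area b c) (area p q) (norm² a) (area a c) (area a b) (norm² c) (norm² p)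
    det₃ = det₀ (norm² p) (area a b) (area p q) (- norm² c) (area b c) (area a c) (norm² b) (norm² q)
    factor₁ = norm² a +′ norm² b -′ norm² c -′ norm² p +′ norm² q +′ norm² r
    factor₂ = norm² b -′ norm² a -′ norm² c -′ norm² p +′ norm² q -′ norm² r
    factor₃ = norm² b -′ norm² a +′ norm² c +′ norm² p +′ norm² q -′ norm² r

open Forms ℚ._+_ ℚ._*_ ℚ.-_ 1ℚ
module P {n : ℕ} = Forms {Polynomial n} _:+_ _:*_ :-_ (con 1ℚ)

det₁-factor : ∀ a b c {p q r} → p ≡ b ⊖ a → q ≡ c ⊖ a → r ≡ c ⊖ b →
  Dets.det₁ a b c p q r ≡ incircle a b c ℚ.* Dets.factor₁ a b c p q r
det₁-factor (a₁ , a₂) (b₁ , b₂) (c₁ , c₂) refl refl refl = solve 6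
  (λ a₁ a₂ b₁ b₂ c₁ c₂ →
    let a = a₁ , a₂ ; b = b₁ , b₂ ; c = c₁ , c₂
        p = b P.⊖ a ; q = c P.⊖ a ; r = c P.⊖ b
    in P.Dets.det₁ a b c p q r := P.incircle a b c :* P.Dets.factor₁ a b c p q r)
  refl a₁ a₂ b₁ b₂ c₁ c₂

det₂-factor : ∀ a b c {p q r} → p ≡ b ⊖ a → q ≡ c ⊖ a → r ≡ c ⊖ b →
  Dets.det₂ a b c p q r ≡ incircle a b c ℚ.* Dets.factor₂ a b c p q r
det₂-factor (a₁ , a₂) (b₁ , b₂) (c₁ , c₂) refl refl refl = solve 6
  (λ a₁ a₂ b₁ b₂ c₁ c₂ →
    let a = a₁ , a₂ ; b = b₁ , b₂ ; c = c₁ , c₂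
        p = b P.⊖ a ; q = c P.⊖ a ; r = c P.⊖ b
    in P.Dets.det₂ a b c p q r := P.incircle a b c :* P.Dets.factor₂ a b c p q r)
  refl a₁ a₂ b₁ b₂ c₁ c₂

det₃-factor : ∀ a b c {p q r} → p ≡ b ⊖ a → q ≡ c ⊖ a → r ≡ c ⊖ b →
  Dets.det₃ a b c p q r ≡ incircle a b c ℚ.* Dets.factor₃ a b c p q r
det₃-factor (a₁ , a₂) (b₁ , b₂) (c₁ , c₂) refl refl refl = solve 6
  (λ a₁ a₂ b₁ b₂ c₁ c₂ →
    let a = a₁ , a₂ ; b = b₁ , b₂ ; c = c₁ , c₂
        p = b P.⊖ a ; q = c P.⊖ a ; r = c P.⊖ b
    in P.Dets.det₃ a b c p q r := P.incircle a b c :* P.Dets.factor₃ a b c p q r)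
  refl a₁ a₂ b₁ b₂ c₁ c₂

-- Changes the origin to `o`: the centre for evaluating `T`, A_i for writing the other three sides
-- through the vectors from A_i.
⊖-translate : ∀ o p q → q ⊖ p ≡ (q ⊖ o) ⊖ (p ⊖ o)
⊖-translate (o₁ , o₂) (p₁ , p₂) (q₁ , q₂) = cong₂ _,_ (translate o₁ p₁ q₁) (translate o₂ p₂ q₂)
  where
    translate : ∀ o p q → q ℚ.- p ≡ (q ℚ.- o) ℚ.- (p ℚ.- o)
    translate = solve 3 (λ o p q → q :- p := (q :- o) :- (p :- o)) refl

-- In |j - i|² = |j|² - |i|² - 2 i·(j - i), and likewise for k and l, the scalar products cancel by
-- the relation area(b,c) a - area(a,c) b + area(a,b) c = 0 among plane vectors.
incircle-from : ∀ i j k l {a b c} → a ≡ j ⊖ i → b ≡ k ⊖ i → c ≡ l ⊖ i →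
  incircle a b c ≡
    area b c ℚ.* (norm² j ℚ.- norm² i) ℚ.- area a c ℚ.* (norm² k ℚ.- norm² i)
      ℚ.+ area a b ℚ.* (norm² l ℚ.- norm² i)
incircle-from (i₁ , i₂) (j₁ , j₂) (k₁ , k₂) (l₁ , l₂) refl refl refl = solve 8
  (λ i₁ i₂ j₁ j₂ k₁ k₂ l₁ l₂ →
    let i = i₁ , i₂ ; j = j₁ , j₂ ; k = k₁ , k₂ ; l = l₁ , l₂
        a = j P.⊖ i ; b = k P.⊖ i ; c = l P.⊖ i
    in P.incircle a b c :=
      P.area b c :* (P.norm² j :- P.norm² i) :- P.area a c :* (P.norm² k :- P.norm² i)
        :+ P.area a b :* (P.norm² l :- P.norm² i))
  refl i₁ i₂ j₁ j₂ k₁ k₂ l₁ l₂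

det-corner₀ : ∀ a b c d e f g h n →
  seq (det ((a ∷ b ∷ c ∷ []) ∷ (d ∷ e ∷ f ∷ []) ∷ (0ℝ ∷ g ∷ h ∷ []) ∷ [])) n ≡
  det₀ (seq a n) (seq b n) (seq c n) (seq d n) (seq e n) (seq f n) (seq g n) (seq h n)
det-corner₀ a b c d e f g h n = solve 8
  (λ a b c d e f g h →
    -- These terms copy the unfolding of `det`: the empty determinant leaves a factor 1, each sum
    -- ends in 0, and every later column adds one negation.
    let det1 x = x :* con 1ℚ :+ con 0ℚ
        det2 x y z w = x :* det1 w :+ (:- (y :* det1 z) :+ con 0ℚ)
    in a :* det2 e f g h :+ (:- (b :* det2 d f (con 0ℚ) h)
         :+ (:- (:- (c :* det2 d e (con 0ℚ) g)) :+ con 0ℚ))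
       := P.det₀ a b c d e f g h)
  refl (seq a n) (seq b n) (seq c n) (seq d n) (seq e n) (seq f n) (seq g n) (seq h n)

at : ℕ → Point → ℚ × ℚ
at n (x , y) = seq x n , seq y n

open VanishingCombinations ℝ-commutativeRing

T : Point → Point → Point → Point → ℝ
T i j k l = S i k l * dist² i j - S i j l * dist² i k + S i j k * dist² i l

concyclic⇒T≈0 : ∀ (c : Circle) i j k l →
  i liesOn c → j liesOn c → k liesOn c → l liesOn c → T i j k l ≈ 0ℝ
concyclic⇒T≈0 c i j k l i∈c j∈c k∈c l∈c =
  ℝ-Ring.trans {T i j k l} {fromCentre} {0ℝ}
    (pointwise-≡⇒≈ (T i j k l) fromCentre λ n →
      -- Positions seen from the centre: their `norm²` are the terms of the squared distances to the
      -- centre.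
      incircle-from (at n i ⊖ at n o) (at n j ⊖ at n o) (at n k ⊖ at n o) (at n l ⊖ at n o)
        (⊖-translate (at n o) (at n i) (at n j))
        (⊖-translate (at n o) (at n i) (at n k))
        (⊖-translate (at n o) (at n i) (at n l)))
    (weighted-differences≈0 (S i k l) (S i j l) (S i j k)
      {dist² o i} {dist² o j} {dist² o k} {dist² o l} {radius * radius}
      i∈c j∈c k∈c l∈c)
  where
    open Circle c using (radius) renaming (centre to o)
    fromCentre : ℝ
    fromCentre = S i k l * (dist² o j - dist² o i) - S i j l * (dist² o k - dist² o i)
      + S i j k * (dist² o l - dist² o i)

theorem2p6 :
  (c : Circle) (Ai Aj Ak Al : Point) →
  let As = Ai List.∷ Aj List.∷ Ak List.∷ Al List.∷ List.[] in
  Distinct As → All (_liesOn c) As → AnticlockwiseOrder Ai Aj Ak Al →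
  let
    x = dist²
    D₁ = det ((x Ak Al     ∷ S Ai Ak Al ∷ S Aj Ak Al ∷ []) ∷
              (- x Ai Aj   ∷ S Ai Aj Ak ∷ S Ai Aj Al ∷ []) ∷
              (0ℝ          ∷ x Ai Ak    ∷ x Aj Al    ∷ []) ∷ [])
    D₂ = det ((x Ak Al     ∷ S Ai Ak Al ∷ S Aj Ak Al ∷ []) ∷
              (x Ai Aj     ∷ S Ai Aj Al ∷ S Ai Aj Ak ∷ []) ∷
              (0ℝ          ∷ x Ai Al    ∷ x Aj Ak    ∷ []) ∷ [])
    D₃ = det ((x Aj Ak     ∷ S Ai Aj Ak ∷ S Aj Ak Al ∷ []) ∷
              (- x Ai Al   ∷ S Ai Ak Al ∷ S Ai Aj Al ∷ []) ∷
              (0ℝ          ∷ x Ai Ak    ∷ x Aj Al    ∷ []) ∷ [])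
  in (D₁ ≈ D₂) × (D₂ ≈ D₃) × (D₃ ≈ 0ℝ)
theorem2p6 c i j k l _ (i∈c All.∷ j∈c All.∷ k∈c All.∷ l∈c All.∷ All.[]) _ =
  all-equal-0 {D₁} {D₂} {D₃} D₁≈0 D₂≈0 D₃≈0
  where
    x = dist²
    D₁ D₂ D₃ : ℝ
    D₁ = det ((x k l ∷ S i k l ∷ S j k l ∷ []) ∷ (- x i j ∷ S i j k ∷ S i j l ∷ []) ∷
              (0ℝ ∷ x i k ∷ x j l ∷ []) ∷ [])
    D₂ = det ((x k l ∷ S i k l ∷ S j k l ∷ []) ∷ (x i j ∷ S i j l ∷ S i j k ∷ []) ∷
              (0ℝ ∷ x i l ∷ x j k ∷ []) ∷ [])
    D₃ = det ((x j k ∷ S i j k ∷ S j k l ∷ []) ∷ (- x i l ∷ S i k l ∷ S i j l ∷ []) ∷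
              (0ℝ ∷ x i k ∷ x j l ∷ []) ∷ [])

    -- Termwise these are `factor₁`, `factor₂`, `factor₃`.
    Q₁ Q₂ Q₃ : ℝ
    Q₁ = x i j + x i k - x i l - x j k + x j l + x k l
    Q₂ = x i k - x i j - x i l - x j k + x j l - x k l
    Q₃ = x i k - x i j + x i l + x j k + x j l - x k l

    T≈0 = concyclic⇒T≈0 c i j k l i∈c j∈c k∈c l∈c

    from-i : ∀ p q n → at n q ⊖ at n p ≡ (at n q ⊖ at n i) ⊖ (at n p ⊖ at n i)
    from-i p q n = ⊖-translate (at n i) (at n p) (at n q)

    D₁≈0 = multiple≈0 {T i j k l} Q₁ {D₁}
      (pointwise-≡⇒≈ D₁ (T i j k l * Q₁) λ n → trans
        (det-corner₀ (x k l) (S i k l) (S j k l) (- x i j) (S i j k) (S i j l) (x i k) (x j l) n)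
        (det₁-factor (at n j ⊖ at n i) (at n k ⊖ at n i) (at n l ⊖ at n i)
          (from-i j k n) (from-i j l n) (from-i k l n)))
      T≈0
    D₂≈0 = multiple≈0 {T i j k l} Q₂ {D₂}
      (pointwise-≡⇒≈ D₂ (T i j k l * Q₂) λ n → trans
        (det-corner₀ (x k l) (S i k l) (S j k l) (x i j) (S i j l) (S i j k) (x i l) (x j k) n)
        (det₂-factor (at n j ⊖ at n i) (at n k ⊖ at n i) (at n l ⊖ at n i)
          (from-i j k n) (from-i j l n) (from-i k l n)))
      T≈0
    D₃≈0 = multiple≈0 {T i j k l} Q₃ {D₃}
      (pointwise-≡⇒≈ D₃ (T i j k l * Q₃) λ n → trans
        (det-corner₀ (x j k) (S i j k) (S j k l) (- x i l) (S i k l) (S i j l) (x i k) (x j l) n)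
        (det₃-factor (at n j ⊖ at n i) (at n k ⊖ at n i) (at n l ⊖ at n i)
          (from-i j k n) (from-i j l n) (from-i k l n)))
      T≈0
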